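{- Let $q$ be a prime power and $\ell = q^3$, and let $\mathbb{F}_\ell$ be the field with $\ell$ elements. Let $a_n, b_n, c_n$ ($n\ge 1$) and the fields $C_n$, $G_n$, $H_n$ ($n \ge 1$) be as defined in the context. Then for every integer $n\ge 2$ we have $H_n = C_n$.
   Context: Let $q$ be a prime power, $\ell=q^3$, and let $\mathbb{F}_\ell(a_1)$ be the rational function field in one variable $a_1$ over $\mathbb{F}_\ell$. All elements and fields below lie in one fixed algebraic closure of $\mathbb{F}_\ell(a_1)$. For each $n\ge 1$, let $a_{n+1}$ be an element satisfying $$\frac{1-a_{n+1}}{a_{n+1}^q} = \frac{a_n^q+a_n-1}{a_n}.$$ For each $n\ge 1$, let $c_n$ and $b_n$ be elements satisfying $$c_n^{q-1} = 1-\frac{1}{a_n}\qquad\text{and}\qquad b_n^{q-1} = -\frac{a_n^q+a_n-1}{a_n}.$$ (The elements $a_{n+1}, b_n, c_n$ are any choices of solutions of these equations.) Define $C_1=\mathbb{F}_\ell(c_1)$ and, for $n\ge 1$, $C_{n+1}=C_n(c_{n+1})$. Define $G_1=\mathbb{F}_\ell(a_1)$ and, for $n\ge 1$, $H_n=G_n(b_n)$ and $G_{n+1}=H_n(a_{n+1})$. The claim $H_n=C_n$ is an equality of subfields of the fixed algebraic closure. -}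

module Defs where

open import Algebra.Apartness.Bundles using (HeytingField; HeytingCommutativeRing)
open import Algebra.Bundles using (CommutativeRing)
open import Algebra.Apartness.Properties.HeytingCommutativeRing using (1#0; x#0y#0→xy#0)
import Algebra.Properties.Semiring.Exp as SemiringExp
open import Algebra.Morphism.Structures using (module RingMorphisms)
open import Data.Fin.Base using (Fin)
open import Data.List.Base using (List; []; _∷_; _++_; [_]; foldr; map)
open import Data.List.Relation.Unary.All using (All)
open import Data.List.Relation.Unary.Any using (Any)
open import Data.Nat.Base as ℕ using (ℕ; zero; suc)
open import Data.Nat.Primality using (Prime)
open import Data.Product.Base using (∃; ∃₂; _×_; proj₁)
open import Function.Bundles using (Inverse)
open import Level using (Level; _⊔_) renaming (suc to lsuc)
open import Relation.Binary.Definitions using (Decidable)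
open import Relation.Binary.PropositionalEquality.Core using (_≡_)
open import Relation.Binary.PropositionalEquality.Properties using () renaming (setoid to ≡-setoid)
open import Relation.Unary using (Pred)

IsPrimePower : ℕ → Set
IsPrimePower q = ∃₂ λ p k → Prime p × 1 ℕ.≤ k × q ≡ p ℕ.^ k

-- A discrete field.  By tightness and the correspondence between apartness and
-- invertibility of differences, decidability of _#_ makes equality decidable
-- and every nonzero element invertible.  Classically these are exactly the
-- fields, with x # y meaning x ≠ y; 0 ≠ 1 is the library's lemma 1#0.
record Field (c ℓ₁ ℓ₂ : Level) : Set (lsuc (c ⊔ ℓ₁ ⊔ ℓ₂)) where
  field
    heytingField : HeytingField c ℓ₁ ℓ₂

  open HeytingField heytingField public

  field
    _#?_ : Decidable _#_

  commutativeRing : CommutativeRing c ℓ₁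
  commutativeRing = HeytingCommutativeRing.commutativeRing heytingCommutativeRing

  open CommutativeRing commutativeRing public using (rawRing; semiring)
  open SemiringExp semiring public using (_^_)

  ^-#0 : ∀ {x} → x # 0# → ∀ n → x ^ n # 0#
  ^-#0 x#0 zero    = 1#0 heytingCommutativeRing
  ^-#0 x#0 (suc n) = x#0y#0→xy#0 heytingCommutativeRing x#0 (^-#0 x#0 n)

  -- The inverse supplied by #⇒invertible is one of y - 0#, hence of y.
  divide : ∀ x y → y # 0# → Carrier
  divide x y y#0 = x * proj₁ (#⇒invertible y#0)

  infix 7 divide
  syntax divide x y y#0 = x / y ⟨ y#0 ⟩

  -- The polynomial c₀ + c₁ X + … + cₙ Xⁿ is the list c₀ ∷ c₁ ∷ … ∷ cₙ ∷ [].
  eval : List Carrier → Carrier → Carrier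
  eval cs x = foldr (λ c r → c + x * r) 0# cs

  IsAlgebraicallyClosed : Set (c ⊔ ℓ₁)
  IsAlgebraicallyClosed = ∀ c₀ cs → ∃ λ x → eval (c₀ ∷ cs ++ [ 1# ]) x ≈ 0#

  IsAlgebraicOver : ∀ {p} → Pred Carrier p → Pred Carrier (c ⊔ ℓ₁ ⊔ ℓ₂ ⊔ p)
  IsAlgebraicOver K x =
    ∃ λ cs → All K cs × Any (_# 0#) cs × eval cs x ≈ 0#

  -- The whole field is an algebraic closure of its subfield K.
  IsAlgebraicClosureOf : ∀ {p} → Pred Carrier p → Set (c ⊔ ℓ₁ ⊔ ℓ₂ ⊔ p)
  IsAlgebraicClosureOf K = IsAlgebraicallyClosed × (∀ x → IsAlgebraicOver K x)

  -- K ⟮ s ⟯ is the subfield generated by K and s.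
  data _⟮_⟯ {p} (K : Pred Carrier p) (s : Carrier) : Pred Carrier (c ⊔ ℓ₁ ⊔ p) where
    base : ∀ {x} → K x → (K ⟮ s ⟯) x
    gen  : (K ⟮ s ⟯) s
    resp : ∀ {x y} → x ≈ y → (K ⟮ s ⟯) x → (K ⟮ s ⟯) y
    0∈   : (K ⟮ s ⟯) 0#
    1∈   : (K ⟮ s ⟯) 1#
    +∈   : ∀ {x y} → (K ⟮ s ⟯) x → (K ⟮ s ⟯) y → (K ⟮ s ⟯) (x + y)
    *∈   : ∀ {x y} → (K ⟮ s ⟯) x → (K ⟮ s ⟯) y → (K ⟮ s ⟯) (x * y)
    -∈   : ∀ {x} → (K ⟮ s ⟯) x → (K ⟮ s ⟯) (- x)
    inv∈ : ∀ {x y} → (K ⟮ s ⟯) x → x * y ≈ 1# → (K ⟮ s ⟯) y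

HasCardinality : ∀ {c ℓ₁ ℓ₂} → Field c ℓ₁ ℓ₂ → ℕ → Set (c ⊔ ℓ₁)
HasCardinality F n = Inverse (CommutativeRing.setoid (Field.commutativeRing F)) (≡-setoid (Fin n))

-- Homomorphisms of fields are automatically injective.
IsEmbedding : ∀ {c ℓ₁ ℓ₂} (F Ω : Field c ℓ₁ ℓ₂) → (Field.Carrier F → Field.Carrier Ω) → Set (c ⊔ ℓ₁)
IsEmbedding F Ω = RingMorphisms.IsRingHomomorphism (Field.rawRing F) (Field.rawRing Ω)

module Extension {c ℓ₁ ℓ₂ : Level} (F Ω : Field c ℓ₁ ℓ₂)
                 (ι : Field.Carrier F → Field.Carrier Ω) where

  private
    module F = Field F
  open Field Ω

  image : Pred Carrier (c ⊔ ℓ₁)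
  image x = ∃ λ y → ι y ≈ x

  IsTranscendental : Pred Carrier (c ⊔ ℓ₁)
  IsTranscendental x = ∀ cs → eval (map ι cs) x ≈ 0# → All (F._≈ F.0#) cs

  -- The sequences are used from index 1 on.  Setting the fields of index 0 to
  -- be the base field F makes C 1 = F(c₁) and G 1 = F(a₁) instances of the
  -- general recursion.
  C : (ℕ → Carrier) → ℕ → Pred Carrier (c ⊔ ℓ₁)
  C c zero    = image
  C c (suc n) = C c n ⟮ c (suc n) ⟯

  mutual
    G : (a b : ℕ → Carrier) → ℕ → Pred Carrier (c ⊔ ℓ₁)
    G a b zero    = image
    G a b (suc n) = H a b n ⟮ a (suc n) ⟯

    H : (a b : ℕ → Carrier) → ℕ → Pred Carrier (c ⊔ ℓ₁)
    H a b zero    = image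
    H a b (suc n) = G a b (suc n) ⟮ b (suc n) ⟯

-- Write a = aₙ and a′ = aₙ₊₁.  The defining equations give
--   (bₙ a′)^(q-1) = cₙ₊₁^(q-1)   and   bₙ₊₁^(q-1) = (a′ (a - 1) cₙ)^(q-1),
-- the second because (a - 1)^q = a^q - 1.  The (q-1)-st roots of unity lie in
-- the constant field, so bₙ a′ ~ cₙ₊₁ and bₙ₊₁ ~ a′ (a - 1) cₙ up to constants.
-- Since aₙ = 1 / (1 - cₙ^(q-1)), each bᵢ with i ≤ n then lies in Cₙ, and each
-- cᵢ in Hₙ; b₁ is recovered from c₂, and c₁ from b₂, hence the restriction
-- to n ≥ 2.

module Submission where

open import Defs
open import Algebra.Bundles using (CommutativeMonoid; CommutativeRing)
open import Algebra.Morphism.Structures using (module RingMorphisms)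
import Algebra.Properties.CommutativeMonoid.Sum as Summation
import Algebra.Properties.CommutativeSemiring.Binomial as Binomial
import Algebra.Properties.CommutativeSemiring.Exp as Exponentiation
import Algebra.Properties.Ring as RingProperties
import Algebra.Properties.Semiring.Mult as Multiplication
import Algebra.Solver.Ring.NaturalCoefficients.Default as SemiringSolver
import Algebra.Apartness.Properties.HeytingCommutativeRing as Apartness
open import Data.Empty using (⊥)
open import Data.Fin.Base using (Fin; zero; suc; toℕ; fromℕ; inject₁; punchIn)
open import Data.Fin.Permutation using (Permutation′)
import Data.Fin.Properties as Fin
open import Data.Nat.Base as ℕ using (ℕ; zero; suc; _≤_; _<_; _∸_; s≤s; z≤n; nonTrivial⇒n>1)
open import Data.Nat.Combinatorics using (_C_; nC1≡n; nCn≡1; nCk≡nC[n∸k]; k>n⇒nCk≡0; nCk+nC[k+1]≡[n+1]C[k+1])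
open import Data.Nat.Divisibility using (_∣_; divides; m∣m*n; >⇒∤)
open import Data.Nat.Primality using (Prime; euclidsLemma; ¬prime[0]; prime⇒nonTrivial; prime⇒nonZero)
import Data.Nat.Properties as ℕ
open import Data.Product.Base using (∃; _×_; _,_; proj₁; proj₂)
open import Data.Sum.Base using (_⊎_; inj₁; inj₂)
open import Data.Vec.Base using (Vec; []; _∷_; replicate)
open import Function.Base using (_∘_)
open import Function.Bundles using (Inverse)
import Function.Construct.Composition as Composition
import Function.Construct.Symmetry as Symmetry
open import Level using (Level; _⊔_)
open import Relation.Binary.Bundles using (Setoid)
open import Relation.Binary.Definitions using (Decidable)
open import Relation.Binary.Core using (_Preserves_⟶_)
open import Relation.Binary.PropositionalEquality.Core as ≡ using (_≡_)
open import Relation.Binary.PropositionalEquality.Properties as ≡ using () renaming (setoid to ≡-setoid)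
import Relation.Binary.Reasoning.Setoid as SetoidReasoning
open import Relation.Nullary.Decidable.Core using (yes; no)
open import Relation.Nullary.Negation.Core using (¬_; contradiction)
open import Relation.Unary using (Pred; _⊆_; _≐_)

private
  variable
    c ℓ₁ ℓ₂ p : Level

-- Divisibility of binomial coefficients by a prime.

nC0≡1 : ∀ n → n C 0 ≡ 1
nC0≡1 n = ≡.trans (nCk≡nC[n∸k] (z≤n {n})) (nCn≡1 n)

-- The absorption identity, by induction on `n`: Pascal's rule splits the left side, the induction
-- hypothesis rewrites both pieces, and Pascal's rule joins them again.
[k+1]*[n+1]C[k+1]≡[n+1]*nCk : ∀ n k → suc k ℕ.* (suc n C suc k) ≡ suc n ℕ.* (n C k)
[k+1]*[n+1]C[k+1]≡[n+1]*nCk n zero = begin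
  1 ℕ.* (suc n C 1)    ≡⟨ ℕ.*-identityˡ _ ⟩
  suc n C 1            ≡⟨ nC1≡n (suc n) ⟩
  suc n                ≡⟨ ℕ.*-identityʳ (suc n) ⟨
  suc n ℕ.* 1          ≡⟨ ≡.cong (suc n ℕ.*_) (nC0≡1 n) ⟨
  suc n ℕ.* (n C 0)    ∎
  where open ≡.≡-Reasoning
[k+1]*[n+1]C[k+1]≡[n+1]*nCk zero (suc k) = begin
  suc (suc k) ℕ.* (1 C suc (suc k)) ≡⟨ ≡.cong (suc (suc k) ℕ.*_) (k>n⇒nCk≡0 (s≤s (s≤s (z≤n {k})))) ⟩
  suc (suc k) ℕ.* 0                 ≡⟨ ℕ.*-zeroʳ (suc (suc k)) ⟩
  0                                 ≡⟨ ≡.cong (1 ℕ.*_) (k>n⇒nCk≡0 (s≤s (z≤n {k}))) ⟨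
  1 ℕ.* (0 C suc k)                 ∎
  where open ≡.≡-Reasoning
[k+1]*[n+1]C[k+1]≡[n+1]*nCk (suc n) (suc k) = begin
  suc (suc k) ℕ.* (suc (suc n) C suc (suc k))
    ≡⟨ ≡.cong (suc (suc k) ℕ.*_) (nCk+nC[k+1]≡[n+1]C[k+1] (suc n) (suc k)) ⟨
  suc (suc k) ℕ.* (A ℕ.+ B)
    ≡⟨ ℕ.*-distribˡ-+ (suc (suc k)) A B ⟩
  (A ℕ.+ suc k ℕ.* A) ℕ.+ suc (suc k) ℕ.* B
    ≡⟨ ≡.cong₂ (λ x y → (A ℕ.+ x) ℕ.+ y)
         ([k+1]*[n+1]C[k+1]≡[n+1]*nCk n k) ([k+1]*[n+1]C[k+1]≡[n+1]*nCk n (suc k)) ⟩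
  (A ℕ.+ suc n ℕ.* (n C k)) ℕ.+ suc n ℕ.* (n C suc k)
    ≡⟨ ℕ.+-assoc A _ _ ⟩
  A ℕ.+ (suc n ℕ.* (n C k) ℕ.+ suc n ℕ.* (n C suc k))
    ≡⟨ ≡.cong (A ℕ.+_) (ℕ.*-distribˡ-+ (suc n) (n C k) (n C suc k)) ⟨
  A ℕ.+ suc n ℕ.* (n C k ℕ.+ n C suc k)
    ≡⟨ ≡.cong (λ x → A ℕ.+ suc n ℕ.* x) (nCk+nC[k+1]≡[n+1]C[k+1] n k) ⟩
  suc (suc n) ℕ.* A ∎
  where
  open ≡.≡-Reasoning
  A = suc n C suc k
  B = suc n C suc (suc k)

-- By the absorption identity the prime divides `suc k` times the coefficient, and `suc k` is too
-- small to be a multiple of it.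
prime∣nCk : ∀ {n} → Prime (suc n) → ∀ k → suc k < suc n → suc n ∣ suc n C suc k
prime∣nCk {n} n-prime k k<n
  with euclidsLemma (suc k) (suc n C suc k) n-prime
         (≡.subst (suc n ∣_) (≡.sym ([k+1]*[n+1]C[k+1]≡[n+1]*nCk n k)) (m∣m*n (n C k)))
... | inj₁ n∣k = contradiction n∣k (>⇒∤ k<n)
... | inj₂ n∣C = n∣C

-- Invariance of sums over a finite set under bijections.

module _ {a b} (S : Setoid c ℓ₁) {N} (finite : Inverse S (≡-setoid (Fin N)))
         (M : CommutativeMonoid a b) where
  private
    module S = Setoid S
    module I = Inverse finite
  open CommutativeMonoid M
  open Summation M

  -- Conjugating `e` by the enumeration gives a permutation of `Fin N`. Used additively for
  -- translation by 1 and multiplicatively for scaling by a unit.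
  sum-reindex : (e : Inverse S S) (f : S.Carrier → Carrier) → f Preserves S._≈_ ⟶ _≈_ →
                sum (f ∘ I.from) ≈ sum (f ∘ Inverse.to e ∘ I.from)
  sum-reindex e f f-cong = trans
    (sum-permute (f ∘ I.from) π)
    (sum-cong-≋ (λ i → f-cong (I.strictlyInverseʳ (Inverse.to e (I.from i)))))
    where
    π : Permutation′ N
    π = Composition.inverse (Composition.inverse (Symmetry.inverse finite) e) finite

-- Arithmetic in discrete fields.

module FieldProperties (K : Field c ℓ₁ ℓ₂) where
  open Field K hiding (zero)
  open CommutativeRing commutativeRing public
    using (commutativeSemiring; +-commutativeMonoid; *-commutativeMonoid; ring)
  open Apartness heytingCommutativeRing using (x-0≈x; 1#0; #-congʳ; x#0y#0→xy#0) public
  open Exponentiation commutativeSemiring public using (^-congˡ; ^-congʳ; ^-distrib-*; ^-assocʳ)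
  open Multiplication semiring public using (×1-homo-*; ×-congʳ; ×-congˡ; ×-homo-1)
    renaming (_×_ to _·_)
  open SemiringSolver commutativeSemiring public using (solve; _:=_; _:+_; _:*_; con)
  open RingProperties ring public using (+-cancelʳ)
  open SetoidReasoning setoid

  _≈?_ : Decidable _≈_
  x ≈? y with x #? y
  ... | yes x#y = no λ x≈y → proj₂ (tight x y) x≈y x#y
  ... | no ¬x#y = yes (proj₁ (tight x y) ¬x#y)

  zero-or-apart : ∀ x → x ≈ 0# ⊎ x # 0#
  zero-or-apart x with x #? 0#
  ... | yes x#0 = inj₂ x#0
  ... | no ¬x#0 = inj₁ (proj₁ (tight x 0#) ¬x#0)

  inverse : ∀ {x} → x # 0# → ∃ λ y → x * y ≈ 1#
  inverse x#0 with #⇒invertible x#0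
  ... | y , _ , xy≈1 = y , trans (*-congʳ (sym (x-0≈x _))) xy≈1

  *-cancelˡ : ∀ {x y z} → x # 0# → x * y ≈ x * z → y ≈ z
  *-cancelˡ {x} {y} {z} x#0 xy≈xz with inverse x#0
  ... | w , xw≈1 = begin
    y           ≈⟨ *-identityˡ y ⟨
    1# * y      ≈⟨ *-congʳ xw≈1 ⟨
    x * w * y   ≈⟨ swap y ⟩
    w * (x * y) ≈⟨ *-congˡ xy≈xz ⟩
    w * (x * z) ≈⟨ swap z ⟨
    x * w * z   ≈⟨ *-congʳ xw≈1 ⟩
    1# * z      ≈⟨ *-identityˡ z ⟩
    z           ∎
    where
    swap : ∀ v → x * w * v ≈ w * (x * v)
    swap v = solve 3 (λ x w v → x :* w :* v := w :* (x :* v)) refl x w v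

  *-cancelˡ-0 : ∀ {x y} → x # 0# → x * y ≈ 0# → y ≈ 0#
  *-cancelˡ-0 x#0 xy≈0 = *-cancelˡ x#0 (trans xy≈0 (sym (zeroʳ _)))

  x^n≈0⇒x≈0 : ∀ n {x} → x ^ n ≈ 0# → x ≈ 0#
  x^n≈0⇒x≈0 n {x} x^n≈0 with zero-or-apart x
  ... | inj₁ x≈0 = x≈0
  ... | inj₂ x#0 = contradiction (^-#0 x#0 n) (proj₂ (tight _ _) x^n≈0)

  1≉0 : ¬ 1# ≈ 0#
  1≉0 1≈0 = proj₂ (tight _ _) 1≈0 1#0

  x-y+y≈x : ∀ x y → (x - y) + y ≈ x
  x-y+y≈x x y = begin
    x - y + y     ≈⟨ +-assoc x (- y) y ⟩
    x + (- y + y) ≈⟨ +-congˡ (-‿inverseˡ y) ⟩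
    x + 0#        ≈⟨ +-identityʳ x ⟩
    x             ∎

  x-y≈0⇒x≈y : ∀ {x y} → x - y ≈ 0# → x ≈ y
  x-y≈0⇒x≈y {x} {y} x-y≈0 = begin
    x         ≈⟨ x-y+y≈x x y ⟨
    x - y + y ≈⟨ +-congʳ x-y≈0 ⟩
    0# + y    ≈⟨ +-identityˡ y ⟩
    y         ∎

  1^n≈1 : ∀ n → 1# ^ n ≈ 1#
  1^n≈1 zero    = refl
  1^n≈1 (suc n) = trans (*-identityˡ _) (1^n≈1 n)

  /-* : ∀ x y (y#0 : y # 0#) → (x / y ⟨ y#0 ⟩) * y ≈ x
  /-* x y y#0 = begin
    (x * y⁻¹) * y ≈⟨ solve 3 (λ x z y → x :* z :* y := x :* (y :* z)) refl x y⁻¹ y ⟩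
    x * (y * y⁻¹) ≈⟨ *-congˡ (trans (*-congʳ (sym (x-0≈x y))) (proj₂ (proj₂ (#⇒invertible y#0)))) ⟩
    x * 1#        ≈⟨ *-identityʳ x ⟩
    x             ∎
    where y⁻¹ = proj₁ (#⇒invertible y#0)

  cross-multiply : ∀ {x y z w y#0 w#0} → x / y ⟨ y#0 ⟩ ≈ z / w ⟨ w#0 ⟩ → x * w ≈ z * y
  cross-multiply {x} {y} {z} {w} {y#0} {w#0} x/y≈z/w = begin
    x * w                         ≈⟨ *-congʳ (/-* x y y#0) ⟨
    (x / y ⟨ y#0 ⟩) * y * w       ≈⟨ *-congʳ (*-congʳ x/y≈z/w) ⟩
    (z / w ⟨ w#0 ⟩) * y * w       ≈⟨ solve 3 (λ r y w → r :* y :* w := r :* w :* y) refl (z / w ⟨ w#0 ⟩) y w ⟩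
    (z / w ⟨ w#0 ⟩) * w * y       ≈⟨ *-congʳ (/-* z w w#0) ⟩
    z * y                         ∎

  -- Characteristic and the Frobenius map

  -- The multiple of 1 by p^k is the k-th power of `p · 1#`, so a nonzero `p · 1#` could be
  -- cancelled factor by factor until 1 = 0.
  p^k·1≈0⇒p·1≈0 : ∀ p k → (p ℕ.^ k) · 1# ≈ 0# → p · 1# ≈ 0#
  p^k·1≈0⇒p·1≈0 p zero    1·1≈0 = contradiction (trans (sym (×-homo-1 1#)) 1·1≈0) 1≉0
  p^k·1≈0⇒p·1≈0 p (suc k) p^k·1≈0 with zero-or-apart (p · 1#)
  ... | inj₁ p·1≈0 = p·1≈0
  ... | inj₂ p·1#0 = p^k·1≈0⇒p·1≈0 p k
    (*-cancelˡ-0 p·1#0 (trans (sym (×1-homo-* p (p ℕ.^ k))) p^k·1≈0))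

  p·1≈0∧p∣n⇒n·x≈0 : ∀ {p n} → p · 1# ≈ 0# → p ∣ n → ∀ x → n · x ≈ 0#
  p·1≈0∧p∣n⇒n·x≈0 {p} {n} p·1≈0 (divides d ≡.refl) x = begin
    (d ℕ.* p) · x            ≈⟨ ×-congʳ (d ℕ.* p) (*-identityˡ x) ⟨
    (d ℕ.* p) · (1# * x)     ≈⟨ Multiplication.×-assoc-* semiring (d ℕ.* p) 1# x ⟨
    ((d ℕ.* p) · 1#) * x     ≈⟨ *-congʳ (×1-homo-* d p) ⟩
    (d · 1#) * (p · 1#) * x  ≈⟨ *-congʳ (*-congˡ p·1≈0) ⟩
    (d · 1#) * 0# * x        ≈⟨ *-congʳ (zeroʳ _) ⟩
    0# * x                   ≈⟨ zeroˡ x ⟩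
    0#                       ∎

  -- In the binomial expansion every term except the two outer ones has a coefficient divisible by
  -- `p`.
  frobenius-+ : ∀ {p} → Prime p → p · 1# ≈ 0# → ∀ x y → (x + y) ^ p ≈ x ^ p + y ^ p
  frobenius-+ {zero}  p-prime _ x y = contradiction p-prime ¬prime[0]
  frobenius-+ {suc n} p-prime p·1≈0 x y = begin
    (x + y) ^ suc n                             ≈⟨ Binomial.theorem commutativeSemiring (suc n) x y ⟩
    term zero + sum (term ∘ suc)                ≈⟨ +-congˡ (sum-init-last (term ∘ suc)) ⟩
    term zero + (sum middle + term (suc (fromℕ n)))
      ≈⟨ +-cong first (+-cong middle≈0 last) ⟩
    y ^ suc n + (0# + x ^ suc n)                ≈⟨ +-congˡ (+-identityˡ _) ⟩
    y ^ suc n + x ^ suc n                       ≈⟨ +-comm _ _ ⟩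
    x ^ suc n + y ^ suc n                       ∎
    where
    open Summation +-commutativeMonoid
    term : Fin (suc (suc n)) → Carrier
    term = Binomial.binomialTerm commutativeSemiring x y (suc n)

    middle : Fin n → Carrier
    middle i = term (suc (inject₁ i))

    first : term zero ≈ y ^ suc n
    first = begin
      (suc n C 0) · (1# * y ^ suc n) ≈⟨ ×-congˡ (nC0≡1 (suc n)) ⟩
      1 · (1# * y ^ suc n)           ≈⟨ ×-homo-1 _ ⟩
      1# * y ^ suc n                 ≈⟨ *-identityˡ _ ⟩
      y ^ suc n                      ∎

    last : term (suc (fromℕ n)) ≈ x ^ suc n
    last = begin
      term (suc (fromℕ n))                    ≈⟨ reflexive (≡.cong (λ k → (suc n C suc k) · (x ^ suc k * y ^ (n ∸ k))) (Fin.toℕ-fromℕ n)) ⟩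
      (suc n C suc n) · (x ^ suc n * y ^ (n ∸ n)) ≈⟨ ×-congˡ (nCn≡1 (suc n)) ⟩
      1 · (x ^ suc n * y ^ (n ∸ n))           ≈⟨ ×-homo-1 _ ⟩
      x ^ suc n * y ^ (n ∸ n)                 ≈⟨ *-congˡ (^-congʳ y (ℕ.n∸n≡0 n)) ⟩
      x ^ suc n * 1#                          ≈⟨ *-identityʳ _ ⟩
      x ^ suc n                               ∎

    middle≈0 : sum middle ≈ 0#
    middle≈0 = trans
      (sum-cong-≋ (λ i → p·1≈0∧p∣n⇒n·x≈0 p·1≈0
        (prime∣nCk p-prime (toℕ (inject₁ i))
          (s≤s (≡.subst (_< n) (≡.sym (Fin.toℕ-inject₁ i)) (Fin.toℕ<n i)))) _))
      (sum-replicate-zero n)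

  frobenius-+-iterate : ∀ {p} → Prime p → p · 1# ≈ 0# → ∀ k x y →
                  (x + y) ^ (p ℕ.^ k) ≈ x ^ (p ℕ.^ k) + y ^ (p ℕ.^ k)
  -- The exponent is 1, and `x ^ 1` unfolds to `x * 1#`, so distributivity suffices.
  frobenius-+-iterate p-prime p·1≈0 zero x y = distribʳ 1# x y
  frobenius-+-iterate {p} p-prime p·1≈0 (suc k) x y = begin
    (x + y) ^ (p ℕ.* pᵏ)                  ≈⟨ ^-assocʳ (x + y) p pᵏ ⟨
    ((x + y) ^ p) ^ pᵏ                    ≈⟨ ^-congˡ pᵏ (frobenius-+ p-prime p·1≈0 x y) ⟩
    (x ^ p + y ^ p) ^ pᵏ                  ≈⟨ frobenius-+-iterate p-prime p·1≈0 k (x ^ p) (y ^ p) ⟩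
    (x ^ p) ^ pᵏ + (y ^ p) ^ pᵏ           ≈⟨ +-cong (^-assocʳ x p pᵏ) (^-assocʳ y p pᵏ) ⟩
    x ^ (p ℕ.* pᵏ) + y ^ (p ℕ.* pᵏ)       ∎
    where pᵏ = p ℕ.^ k

  -- Roots of monic polynomials

  -- The vector c₀ ∷ … ∷ cₙ₋₁ ∷ [] stands for c₀ + c₁ X + … + cₙ₋₁ Xⁿ⁻¹ + Xⁿ.
  evalMonic : ∀ {n} → Vec Carrier n → Carrier → Carrier
  evalMonic []       x = 1#
  evalMonic (c ∷ cs) x = c + x * evalMonic cs x

  -- Synthetic division by X - r: the lower coefficients of the quotient are the values at `r` of
  -- the successive tails, as in Horner's scheme.
  quotient : ∀ {n} → Vec Carrier (suc n) → Carrier → Vec Carrier n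
  quotient (c ∷ [])         r = []
  quotient (c ∷ cs@(_ ∷ _)) r = evalMonic cs r ∷ quotient cs r

  -- This is P(x) - P(r) = (x - r) Q(x) with the negative terms moved across, so that the semiring
  -- solver applies.
  evalMonic-quotient : ∀ {n} (cs : Vec Carrier (suc n)) r x →
    evalMonic cs x + r * evalMonic (quotient cs r) x ≈ evalMonic cs r + x * evalMonic (quotient cs r) x
  evalMonic-quotient (c ∷ []) r x =
    solve 3 (λ c x r → c :+ x :* con 1 :+ r :* con 1 := c :+ r :* con 1 :+ x :* con 1) refl c x r
  evalMonic-quotient (c ∷ cs@(_ ∷ _)) r x = begin
    c + x * e x + r * (e r + x * q)   ≈⟨ solve 6 (λ c x r ex er q → c :+ x :* ex :+ r :* (er :+ x :* q) := (c :+ r :* er) :+ x :* (ex :+ r :* q)) refl c x r (e x) (e r) q ⟩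
    (c + r * e r) + x * (e x + r * q) ≈⟨ +-congˡ (*-congˡ (evalMonic-quotient cs r x)) ⟩
    (c + r * e r) + x * (e r + x * q) ∎
    where
    e = evalMonic cs
    q = evalMonic (quotient cs r) x

  -- Induction on the degree: after division by X - r₀ the remaining roots, being different from r₀,
  -- are roots of the quotient. In degree 0 the polynomial is 1.
  monic-roots : ∀ {n} (cs : Vec Carrier n) (r : Fin (suc n) → Carrier) →
                (∀ i → evalMonic cs (r i) ≈ 0#) → (∀ i j → r i ≈ r j → i ≡ j) → ⊥
  monic-roots [] r roots _ = 1≉0 (roots zero)
  monic-roots {suc n} cs r roots inj =
    monic-roots (quotient cs r₀) (r ∘ suc) roots′ (λ i j → Fin.suc-injective ∘ inj (suc i) (suc j))
    where
    r₀ = r zero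
    roots′ : ∀ i → evalMonic (quotient cs r₀) (r (suc i)) ≈ 0#
    roots′ i with zero-or-apart (evalMonic (quotient cs r₀) (r (suc i)))
    ... | inj₁ q≈0 = q≈0
    ... | inj₂ q#0 with inj zero (suc i) (*-cancelˡ q#0 (begin
        q * r₀                    ≈⟨ *-comm q r₀ ⟩
        r₀ * q                    ≈⟨ +-identityˡ _ ⟨
        0# + r₀ * q               ≈⟨ +-congʳ (roots (suc i)) ⟨
        evalMonic cs x + r₀ * q   ≈⟨ evalMonic-quotient cs r₀ x ⟩
        evalMonic cs r₀ + x * q   ≈⟨ +-congʳ (roots zero) ⟩
        0# + x * q                ≈⟨ +-identityˡ _ ⟩
        x * q                     ≈⟨ *-comm x q ⟩
        q * x                     ∎))
        where
        x = r (suc i)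
        q = evalMonic (quotient cs r₀) x
    ...   | ()

  -- The polynomial X^(n+2) - X; the leading coefficient is implicit and the shift by 2 leaves room
  -- for the two lowest ones.
  X^_-X : ∀ n → Vec Carrier (suc (suc n))
  X^ n -X = 0# ∷ (- 1#) ∷ replicate n 0#

  evalMonic-X^n-X : ∀ n {x} → x ^ suc (suc n) ≈ x → evalMonic (X^ n -X) x ≈ 0#
  evalMonic-X^n-X n {x} x^n≈x = begin
    0# + x * (- 1# + x * evalMonic (replicate n 0#) x) ≈⟨ +-identityˡ _ ⟩
    x * (- 1# + x * evalMonic (replicate n 0#) x)      ≈⟨ *-congˡ (+-congˡ (*-congˡ (power n))) ⟩
    x * (- 1# + x ^ suc n)                              ≈⟨ distribˡ x (- 1#) _ ⟩
    x * - 1# + x ^ suc (suc n)                          ≈⟨ +-congˡ x^n≈x ⟩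
    x * - 1# + x                                        ≈⟨ +-congˡ (*-identityʳ x) ⟨
    x * - 1# + x * 1#                                   ≈⟨ distribˡ x (- 1#) 1# ⟨
    x * (- 1# + 1#)                                     ≈⟨ *-congˡ (-‿inverseˡ 1#) ⟩
    x * 0#                                              ≈⟨ zeroʳ x ⟩
    0#                                                  ∎
    where
    power : ∀ k → evalMonic (replicate k 0#) x ≈ x ^ k
    power zero    = refl
    power (suc k) = trans (+-identityˡ _) (*-congˡ (power k))

-- Finite fields: characteristic and Fermat's little theorem.

module FiniteField (K : Field c ℓ₁ ℓ₂) {N} (finite : HasCardinality K N) where
  open Field K hiding (zero)
  open FieldProperties K
  private
    module I = Inverse finite
  open SetoidReasoning setoid

  to-injective : ∀ {x y} → I.to x ≡ I.to y → x ≈ y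
  to-injective {x} {y} eq = begin
    x                   ≈⟨ I.strictlyInverseʳ x ⟨
    I.from (I.to x)     ≡⟨ ≡.cong I.from eq ⟩
    I.from (I.to y)     ≈⟨ I.strictlyInverseʳ y ⟩
    y                   ∎

  from-injective : ∀ {i j} → I.from i ≈ I.from j → i ≡ j
  from-injective {i} {j} eq =
    ≡.trans (≡.sym (I.strictlyInverseˡ i)) (≡.trans (I.to-cong eq) (I.strictlyInverseˡ j))

  -- Translation by 1 permutes the field, so it preserves the sum of all elements while adding
  -- `N · 1#` to it.
  N·1≈0 : N · 1# ≈ 0#
  N·1≈0 = +-cancelʳ (sum I.from) _ _ (begin
    N · 1# + sum I.from                ≈⟨ +-congʳ (sum-replicate N) ⟨
    sum {N} (λ _ → 1#) + sum I.from    ≈⟨ ∑-distrib-+ {N} (λ _ → 1#) I.from ⟨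
    sum (λ i → 1# + I.from i)          ≈⟨ sum-reindex setoid finite +-commutativeMonoid translation (λ x → x) (λ x → x) ⟨
    sum I.from                         ≈⟨ +-identityˡ _ ⟨
    0# + sum I.from                    ∎)
    where
    open Summation +-commutativeMonoid
    cancel : ∀ {x y} → x + y ≈ 0# → ∀ z → x + (y + z) ≈ z
    cancel {x} {y} x+y≈0 z = trans (sym (+-assoc x y z)) (trans (+-congʳ x+y≈0) (+-identityˡ z))

    translation : Inverse setoid setoid
    translation = record
      { to        = 1# +_
      ; from      = - 1# +_
      ; to-cong   = +-congˡ
      ; from-cong = +-congˡ
      ; inverse   = (λ y≈ → trans (+-congˡ y≈) (cancel (-‿inverseʳ 1#) _))
                  , (λ y≈ → trans (+-congˡ y≈) (cancel (-‿inverseˡ 1#) _))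
      }

  private
    -- The value at 0 is 1, so that products over all elements are products
    -- over the nonzero ones.
    onNonzero : (Carrier → Carrier) → Carrier → Carrier
    onNonzero f x with x #? 0#
    ... | yes _ = f x
    ... | no  _ = 1#

    onNonzero-# : ∀ f {x} → x # 0# → onNonzero f x ≈ f x
    onNonzero-# f {x} x#0 with x #? 0#
    ... | yes _    = refl
    ... | no ¬x#0  = contradiction x#0 ¬x#0

    onNonzero-0 : ∀ f {x} → x ≈ 0# → onNonzero f x ≈ 1#
    onNonzero-0 f {x} x≈0 with x #? 0#
    ... | yes x#0 = contradiction x#0 (proj₂ (tight _ _) x≈0)
    ... | no  _   = refl

    nonzero : Carrier → Carrier
    nonzero = onNonzero (λ x → x)

    nonzero-cong : nonzero Preserves _≈_ ⟶ _≈_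
    nonzero-cong {x} {y} x≈y with zero-or-apart x
    ... | inj₁ x≈0 = trans (onNonzero-0 _ x≈0) (sym (onNonzero-0 _ (trans (sym x≈y) x≈0)))
    ... | inj₂ x#0 = trans (onNonzero-# _ x#0) (trans x≈y (sym (onNonzero-# _ (#-congʳ x≈y x#0))))

    nonzero-#0 : ∀ x → nonzero x # 0#
    nonzero-#0 x with x #? 0#
    ... | yes x#0 = x#0
    ... | no  _   = 1#0

    nonzero-* : ∀ {y} → y # 0# → ∀ x → nonzero (y * x) ≈ onNonzero (λ _ → y) x * nonzero x
    nonzero-* {y} y#0 x with zero-or-apart x
    ... | inj₁ x≈0 = begin
      nonzero (y * x)                     ≈⟨ onNonzero-0 _ (trans (*-congˡ x≈0) (zeroʳ y)) ⟩
      1#                                  ≈⟨ *-identityˡ 1# ⟨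
      1# * 1#                             ≈⟨ *-cong (onNonzero-0 _ x≈0) (onNonzero-0 _ x≈0) ⟨
      onNonzero (λ _ → y) x * nonzero x   ∎
    ... | inj₂ x#0 = begin
      nonzero (y * x)                     ≈⟨ onNonzero-# _ (x#0y#0→xy#0 y#0 x#0) ⟩
      y * x                               ≈⟨ *-cong (onNonzero-# _ x#0) (onNonzero-# _ x#0) ⟨
      onNonzero (λ _ → y) x * nonzero x   ∎

  open Summation *-commutativeMonoid using () renaming
    (sum to ∏; sum-cong-≋ to ∏-cong; ∑-distrib-+ to ∏-distrib-*; sum-replicate to ∏-replicate; sum-remove to ∏-remove)

  ∏-#0 : ∀ {n} (f : Fin n → Carrier) → (∀ i → f i # 0#) → ∏ f # 0#
  ∏-#0 {zero}  f f#0 = 1#0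
  ∏-#0 {suc n} f f#0 = x#0y#0→xy#0 (f#0 zero) (∏-#0 (f ∘ suc) (f#0 ∘ suc))

  -- Multiplication by y permutes the nonzero elements, so it multiplies their
  -- product by y ^ (N ∸ 1) without changing it.
  ∏-onNonzero : ∀ {y} → y # 0# → ∏ (onNonzero (λ _ → y) ∘ I.from) ≈ 1#
  ∏-onNonzero {y} y#0 = *-cancelˡ (∏-#0 (nonzero ∘ I.from) (nonzero-#0 ∘ I.from)) (begin
    ∏ (nonzero ∘ I.from) * ∏ (onNonzero (λ _ → y) ∘ I.from)
      ≈⟨ *-comm _ _ ⟩
    ∏ (onNonzero (λ _ → y) ∘ I.from) * ∏ (nonzero ∘ I.from)
      ≈⟨ ∏-distrib-* (onNonzero (λ _ → y) ∘ I.from) (nonzero ∘ I.from) ⟨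
    ∏ (λ i → onNonzero (λ _ → y) (I.from i) * nonzero (I.from i))
      ≈⟨ ∏-cong (λ i → nonzero-* y#0 (I.from i)) ⟨
    ∏ (λ i → nonzero (y * I.from i))
      ≈⟨ sum-reindex setoid finite *-commutativeMonoid scaling nonzero nonzero-cong ⟨
    ∏ (nonzero ∘ I.from)
      ≈⟨ *-identityʳ _ ⟨
    ∏ (nonzero ∘ I.from) * 1# ∎)
    where
    z = proj₁ (inverse y#0)
    yz≈1 = proj₂ (inverse y#0)

    cancel : ∀ {x y} → x * y ≈ 1# → ∀ z → x * (y * z) ≈ z
    cancel {x} {y} xy≈1 z = trans (sym (*-assoc x y z)) (trans (*-congʳ xy≈1) (*-identityˡ z))

    scaling : Inverse setoid setoid
    scaling = record
      { to        = y *_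
      ; from      = z *_
      ; to-cong   = *-congˡ
      ; from-cong = *-congˡ
      ; inverse   = (λ x≈ → trans (*-congˡ x≈) (cancel yz≈1 _))
                  , (λ x≈ → trans (*-congˡ x≈) (cancel (trans (*-comm z y) yz≈1) _))
      }

  -- The extra factor `y` replaces the exceptional entry, which avoids the exponent n - 1.
  ∏-allButOne : ∀ {n y} (f : Fin n → Carrier) i → f i ≈ 1# → (∀ j → ¬ j ≡ i → f j ≈ y) → y * ∏ f ≈ y ^ n
  ∏-allButOne {suc n} {y} f i fi≈1 fj≈y = *-congˡ (begin
    ∏ f                          ≈⟨ ∏-remove {i = i} f ⟩
    f i * ∏ (f ∘ punchIn i)      ≈⟨ *-cong fi≈1 (∏-cong (λ j → fj≈y _ (Fin.punchInᵢ≢i i j))) ⟩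
    1# * ∏ {n} (λ _ → y)         ≈⟨ *-identityˡ _ ⟩
    ∏ {n} (λ _ → y)              ≈⟨ ∏-replicate n ⟩
    y ^ n                        ∎)

  fermat : ∀ x → x ^ N ≈ x
  fermat x with zero-or-apart x
  -- The index `I.to 0#` witnesses that `N` is positive, without which the power would be 1.
  ... | inj₁ x≈0 = trans (0^n (I.to 0#)) (sym x≈0)
    where
    0^n : ∀ {n} → Fin n → x ^ n ≈ 0#
    0^n {suc n} _ = trans (*-congʳ x≈0) (zeroˡ _)
  ... | inj₂ x#0 = begin
    x ^ N                                    ≈⟨ ∏-allButOne (onNonzero (λ _ → x) ∘ I.from) (I.to 0#) at-0 off-0 ⟨
    x * ∏ (onNonzero (λ _ → x) ∘ I.from)     ≈⟨ *-congˡ (∏-onNonzero x#0) ⟩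
    x * 1#                                   ≈⟨ *-identityʳ x ⟩
    x                                        ∎
    where
    at-0 : onNonzero (λ _ → x) (I.from (I.to 0#)) ≈ 1#
    at-0 = onNonzero-0 _ (I.strictlyInverseʳ 0#)

    off-0 : ∀ j → ¬ j ≡ I.to 0# → onNonzero (λ _ → x) (I.from j) ≈ x
    off-0 j j≢0 with zero-or-apart (I.from j)
    ... | inj₁ ≈0 = contradiction (≡.trans (≡.sym (I.strictlyInverseˡ j)) (I.to-cong ≈0)) j≢0
    ... | inj₂ #0 = onNonzero-# _ #0

-- Roots of unity and the constant field.

module Embedding (F Ω : Field c ℓ₁ ℓ₂) (ι : Field.Carrier F → Field.Carrier Ω) (embedding : IsEmbedding F Ω ι) where
  private
    module F where
      open Field F public hiding (zero)
      open FieldProperties F public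
  open Field Ω hiding (zero)
  open FieldProperties Ω
  open Extension F Ω ι
  open RingMorphisms.IsRingHomomorphism embedding
  open SetoidReasoning setoid

  -- A nonzero difference is invertible, and its image would be an invertible zero.
  ι-injective : ∀ {x y} → ι x ≈ ι y → x F.≈ y
  ι-injective {x} {y} ιx≈ιy with F.zero-or-apart (x F.- y)
  ... | inj₁ x-y≈0 = F.x-y≈0⇒x≈y x-y≈0
  ... | inj₂ x-y#0 with F.inverse x-y#0
  ...   | z , [x-y]z≈1 = contradiction (begin
    1#                      ≈⟨ 1#-homo ⟨
    ι F.1#                  ≈⟨ ⟦⟧-cong [x-y]z≈1 ⟨
    ι ((x F.- y) F.* z)     ≈⟨ *-homo _ z ⟩
    ι (x F.- y) * ι z       ≈⟨ *-congʳ (trans (+-homo x _) (+-cong ιx≈ιy (-‿homo y))) ⟩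
    (ι y - ι y) * ι z       ≈⟨ *-congʳ (-‿inverseʳ (ι y)) ⟩
    0# * ι z                ≈⟨ zeroˡ _ ⟩
    0#                      ∎) 1≉0

  ^-homo : ∀ x n → ι (x F.^ n) ≈ ι x ^ n
  ^-homo x zero    = 1#-homo
  ^-homo x (suc n) = trans (*-homo x _) (*-congˡ (^-homo x n))

  ·1-homo : ∀ n → ι (n F.· F.1#) ≈ n · 1#
  ·1-homo zero    = 0#-homo
  ·1-homo (suc n) = trans (+-homo _ _) (+-cong 1#-homo (·1-homo n))

  -- By Fermat the images of the `N` elements of `F` are `N` distinct roots of X^N - X; an `x`
  -- outside the image would be one root too many.
  x^N≈x⇒x∈image : ∀ {N} → HasCardinality F N → ∀ {x} → x ^ N ≈ x → image x
  x^N≈x⇒x∈image {zero} finite with Inverse.to finite F.0#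
  ... | ()
  -- With a single element, 1 and 0 would coincide.
  x^N≈x⇒x∈image {suc zero} finite with Inverse.to finite F.1# in eq₁ | Inverse.to finite F.0# in eq₀
  ... | zero | zero = contradiction
    (FiniteField.to-injective F finite (≡.trans eq₁ (≡.sym eq₀))) F.1≉0
  x^N≈x⇒x∈image {suc (suc n)} finite {x} x^N≈x with Fin.any? (λ i → ι (Inverse.from finite i) ≈? x)
  ... | yes (i , ιi≈x) = Inverse.from finite i , ιi≈x
  ... | no none = contradiction inj (monic-roots (X^ n -X) r (λ i → evalMonic-X^n-X n (root i)))
    where
    module I = Inverse finite
    r : Fin (suc (suc (suc n))) → Carrier
    r zero    = x
    r (suc i) = ι (I.from i)

    root : ∀ i → r i ^ suc (suc n) ≈ r i
    root zero    = x^N≈x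
    root (suc i) = trans (sym (^-homo (I.from i) (suc (suc n)))) (⟦⟧-cong (FiniteField.fermat F finite (I.from i)))

    inj : ∀ i j → r i ≈ r j → i ≡ j
    inj zero    zero    _ = ≡.refl
    inj zero    (suc j) e = contradiction (j , sym e) none
    inj (suc i) zero    e = contradiction (i , e) none
    inj (suc i) (suc j) e = ≡.cong suc (FiniteField.from-injective F finite (ι-injective e))

  -- The exponent suc m is q - 1, for q = suc (suc m).
  x^m≈y^m⇒x≈ζy : ∀ m k → HasCardinality F (suc (suc m) ℕ.^ k) → ∀ {x y} →
                 x ^ suc m ≈ y ^ suc m → ∃ λ ζ → image ζ × x ≈ ζ * y
  x^m≈y^m⇒x≈ζy m k finite {x} {y} x^m≈y^m with zero-or-apart y
  -- Here `x` vanishes too, so any constant serves; 1 is chosen.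
  ... | inj₁ y≈0 = 1# , (F.1# , 1#-homo) ,
    trans (x^n≈0⇒x≈0 (suc m) (trans x^m≈y^m (trans (*-congʳ y≈0) (zeroˡ _)))) (sym (trans (*-congˡ y≈0) (zeroʳ _)))
  ... | inj₂ y#0 with inverse y#0
  ...   | z , yz≈1 = x * z , x^N≈x⇒x∈image finite (ζ^[q^k]≈ζ k) , sym (begin
    x * z * y     ≈⟨ *-assoc x z y ⟩
    x * (z * y)   ≈⟨ *-congˡ (trans (*-comm z y) yz≈1) ⟩
    x * 1#        ≈⟨ *-identityʳ x ⟩
    x             ∎)
    where
    ζ^m≈1 : (x * z) ^ suc m ≈ 1#
    ζ^m≈1 = begin
      (x * z) ^ suc m         ≈⟨ ^-distrib-* x z (suc m) ⟩
      x ^ suc m * z ^ suc m   ≈⟨ *-congʳ x^m≈y^m ⟩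
      y ^ suc m * z ^ suc m   ≈⟨ ^-distrib-* y z (suc m) ⟨
      (y * z) ^ suc m         ≈⟨ ^-congˡ (suc m) yz≈1 ⟩
      1# ^ suc m              ≈⟨ 1^n≈1 (suc m) ⟩
      1#                      ∎

    -- From ζ^(q-1) = 1 follows ζ^q = ζ, hence ζ is fixed by every iterate and is a root of X^N - X
    -- for N = q^k.
    ζ^[q^k]≈ζ : ∀ k → (x * z) ^ (suc (suc m) ℕ.^ k) ≈ x * z
    ζ^[q^k]≈ζ zero    = *-identityʳ _
    ζ^[q^k]≈ζ (suc k) = begin
      (x * z) ^ (suc (suc m) ℕ.* suc (suc m) ℕ.^ k)   ≈⟨ ^-assocʳ (x * z) (suc (suc m)) (suc (suc m) ℕ.^ k) ⟨
      ((x * z) * (x * z) ^ suc m) ^ (suc (suc m) ℕ.^ k) ≈⟨ ^-congˡ (suc (suc m) ℕ.^ k) (trans (*-congˡ ζ^m≈1) (*-identityʳ _)) ⟩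
      (x * z) ^ (suc (suc m) ℕ.^ k)                    ≈⟨ ζ^[q^k]≈ζ k ⟩
      x * z                                            ∎

-- Subfields and adjunction.

module Subfields (K : Field c ℓ₁ ℓ₂) where
  open Field K hiding (zero)
  open FieldProperties K
  open SetoidReasoning setoid

  record IsSubfield (L : Pred Carrier p) : Set (c ⊔ ℓ₁ ⊔ p) where
    field
      resp∈ : ∀ {x y} → x ≈ y → L x → L y
      zero∈ : L 0#
      one∈  : L 1#
      add∈  : ∀ {x y} → L x → L y → L (x + y)
      mul∈  : ∀ {x y} → L x → L y → L (x * y)
      neg∈  : ∀ {x} → L x → L (- x)
      inverse∈ : ∀ {x y} → L x → x * y ≈ 1# → L y

    pow∈ : ∀ {x} n → L x → L (x ^ n)
    pow∈ zero    x∈ = one∈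
    pow∈ (suc n) x∈ = mul∈ x∈ (pow∈ n x∈)

    factor∈ : ∀ {x y z} → x * y ≈ z → x # 0# → L x → L z → L y
    factor∈ {x} {y} {z} xy≈z x#0 x∈ z∈ with inverse x#0
    ... | w , xw≈1 = resp∈ (*-cancelˡ x#0 (begin
      x * (w * z)  ≈⟨ *-assoc x w z ⟨
      (x * w) * z  ≈⟨ *-congʳ xw≈1 ⟩
      1# * z       ≈⟨ *-identityˡ z ⟩
      z            ≈⟨ xy≈z ⟨
      x * y        ∎)) (mul∈ (inverse∈ x∈ xw≈1) z∈)

  adjoin-isSubfield : (L : Pred Carrier p) (s : Carrier) → IsSubfield (L ⟮ s ⟯)
  adjoin-isSubfield L s = record
    { resp∈ = resp ; zero∈ = 0∈ ; one∈ = 1∈ ; add∈ = +∈ ; mul∈ = *∈ ; neg∈ = -∈ ; inverse∈ = inv∈ }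

  adjoin-least : ∀ {p′} {L : Pred Carrier p} {M : Pred Carrier p′} {s} →
                 IsSubfield M → L ⊆ M → M s → L ⟮ s ⟯ ⊆ M
  adjoin-least {L = L} {M} {s} M-sub L⊆M s∈ = go
    where
    open IsSubfield M-sub
    go : L ⟮ s ⟯ ⊆ M
    go (base x∈)       = L⊆M x∈
    go gen             = s∈
    go (resp x≈y x∈)   = resp∈ x≈y (go x∈)
    go 0∈              = zero∈
    go 1∈              = one∈
    go (+∈ x∈ y∈)      = add∈ (go x∈) (go y∈)
    go (*∈ x∈ y∈)      = mul∈ (go x∈) (go y∈)
    go (-∈ x∈)         = neg∈ (go x∈)
    go (inv∈ x∈ xy≈1)  = inverse∈ (go x∈) xy≈1

-- The equations of the tower and their consequences.

module Tower
  (F Ω : Field c ℓ₁ ℓ₂) (ι : Field.Carrier F → Field.Carrier Ω) (embedding : IsEmbedding F Ω ι)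
  (m : ℕ) (finite : HasCardinality F (suc (suc m) ℕ.^ 3))
  where
  open Field Ω hiding (zero)
  open Extension F Ω ι
  open FieldProperties Ω
  open Subfields Ω
  open Embedding F Ω ι embedding
  open IsSubfield
  open SetoidReasoning setoid

  private
    q : ℕ
    q = suc (suc m)

  -- The equations of the tower are cleared of denominators, and of
  -- subtractions so that the semiring solver applies.
  module Equations
    (frobenius : ∀ x y → (x + y) ^ q ≈ x ^ q + y ^ q)
    (a b c : ℕ → Carrier)
    (a#0 : ∀ n → a (suc n) # 0#)
    (a-eq : ∀ n → a (suc n) + a (suc (suc n)) ^ q
                    ≈ (a (suc n) ^ q + a (suc n)) * a (suc (suc n)) ^ q + a (suc (suc n)) * a (suc n))
    (c-eq : ∀ n → c (suc n) ^ suc m * a (suc n) + 1# ≈ a (suc n))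
    (b-eq : ∀ n → b (suc n) ^ suc m * a (suc n) + (a (suc n) ^ q + a (suc n)) ≈ 1#)
    where

    -- With x = aₙ and y = aₙ₊₁, the recursion reads bₙ^(q-1) = (y - 1) / y^q; multiplying by
    -- y^(q-1) gives 1 - 1/y. The proof checks this after multiplication by x y and addition of x +
    -- y^q, the left side of `a-eq`.
    [bₙaₙ₊₁]^m≈cₙ₊₁^m : ∀ n → (b (suc n) * a (suc (suc n))) ^ suc m ≈ c (suc (suc n)) ^ suc m
    [bₙaₙ₊₁]^m≈cₙ₊₁^m n = *-cancelˡ (a#0 n) (*-cancelˡ (a#0 (suc n)) (+-cancelʳ (x + y ^ q) _ _ (begin
      y * (x * (u * y) ^ suc m) + (x + y ^ q)
        ≈⟨ +-cong (*-congˡ (*-congˡ (^-distrib-* u y (suc m)))) (a-eq n) ⟩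
      y * (x * (uᵐ * yᵐ)) + ((x ^ q + x) * y ^ q + y * x)
        ≈⟨ solve 5 (λ x y u v z → y :* (x :* (u :* v)) :+ (z :* (y :* v) :+ y :* x)
                               := (u :* x :+ z) :* (y :* v) :+ y :* x) refl x y uᵐ yᵐ (x ^ q + x) ⟩
      (uᵐ * x + (x ^ q + x)) * y ^ q + y * x
        ≈⟨ +-cong (*-congʳ (b-eq n)) (*-congʳ (sym (c-eq (suc n)))) ⟩
      1# * y ^ q + (wᵐ * y + 1#) * x
        ≈⟨ solve 4 (λ x y w z → con 1 :* z :+ (w :* y :+ con 1) :* x
                             := y :* (x :* w) :+ (x :+ z)) refl x y wᵐ (y ^ q) ⟩
      y * (x * wᵐ) + (x + y ^ q) ∎)))
      where
      x = a (suc n)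
      y = a (suc (suc n))
      u = b (suc n)
      uᵐ = u ^ suc m
      yᵐ = y ^ suc m
      wᵐ = c (suc (suc n)) ^ suc m

    -- a (suc n) - 1# in a form without subtraction.
    a-1 : ℕ → Carrier
    a-1 n = c (suc n) ^ suc m * a (suc n)

    -- With a = a (suc n), the equation (a - 1) ^ q ≈ a ^ q - 1 makes the right-hand side a perfect (q - 1)-st power.
    bₙ₊₁^m≈[aₙ₊₁[aₙ-1]cₙ]^m : ∀ n → b (suc (suc n)) ^ suc m ≈ (a (suc (suc n)) * (a-1 n * c (suc n))) ^ suc m
    bₙ₊₁^m≈[aₙ₊₁[aₙ-1]cₙ]^m n = *-cancelˡ (a#0 n) (*-cancelˡ (a#0 (suc n)) (+-cancelʳ (y ^ q * x + y * x + y ^ q) _ _ (begin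
      y * (x * uᵐ) + (y ^ q * x + y * x + y ^ q)
        ≈⟨ solve 4 (λ x y u z → y :* (x :* u) :+ (z :* x :+ y :* x :+ z)
                             := (u :* y :+ (z :+ y)) :* x :+ z) refl x y uᵐ (y ^ q) ⟩
      (uᵐ * y + (y ^ q + y)) * x + y ^ q
        ≈⟨ +-congʳ (trans (*-congʳ (b-eq (suc n))) (*-identityˡ x)) ⟩
      x + y ^ q
        ≈⟨ a-eq n ⟩
      (x ^ q + x) * y ^ q + y * x
        ≈⟨ +-congʳ (*-congʳ (+-congʳ x^q≈v^q+1)) ⟩
      (v ^ q + 1# + x) * y ^ q + y * x
        -- One factor `v` of v^q is expanded to `wᵐ * x`. Its `x` is the factor cancelled at the
        -- end, and its `wᵐ` supplies the power of `c (suc n)`.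
        ≈⟨ solve 6 (λ x y yᵐ v vᵐ w → (w :* x :* vᵐ :+ con 1 :+ x) :* (y :* yᵐ) :+ y :* x
              := y :* (x :* (yᵐ :* (vᵐ :* w))) :+ (y :* yᵐ :* x :+ y :* x :+ y :* yᵐ))
            refl x y (y ^ suc m) v (v ^ suc m) wᵐ ⟩
      y * (x * (y ^ suc m * (v ^ suc m * wᵐ))) + (y ^ q * x + y * x + y ^ q)
        ≈⟨ +-congʳ (*-congˡ (*-congˡ (trans (^-distrib-* y (v * w) (suc m)) (*-congˡ (^-distrib-* v w (suc m)))))) ⟨
      y * (x * (y * (v * w)) ^ suc m) + (y ^ q * x + y * x + y ^ q) ∎)))
      where
      x = a (suc n)
      y = a (suc (suc n))
      w = c (suc n)
      v = a-1 n
      uᵐ = b (suc (suc n)) ^ suc m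
      wᵐ = w ^ suc m
      x^q≈v^q+1 : x ^ q ≈ v ^ q + 1#
      x^q≈v^q+1 = begin
        x ^ q         ≈⟨ ^-congˡ q (c-eq n) ⟨
        (v + 1#) ^ q  ≈⟨ frobenius v 1# ⟩
        v ^ q + 1# ^ q ≈⟨ +-congˡ (1^n≈1 q) ⟩
        v ^ q + 1#    ∎

    -- Membership of the generators in a subfield containing the constants.

    module _ {p} {L : Pred Carrier p} (sub : IsSubfield L) (F⊆L : image ⊆ L) where

      -- The two elements differ by a (q-1)-st root of unity, which is a constant and so lies in
      -- `L`.
      ∈-cong-root : ∀ {x y} → x ^ suc m ≈ y ^ suc m → L y → L x
      ∈-cong-root x^m≈y^m y∈ with x^m≈y^m⇒x≈ζy m 3 finite x^m≈y^m
      ... | ζ , ζ∈ , x≈ζy = resp∈ sub (sym x≈ζy) (mul∈ sub (F⊆L ζ∈) y∈)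

      -- The equation for c inverts to a = 1 / (1 - c^(q-1)).
      c∈⇒a∈ : ∀ n → L (c (suc n)) → L (a (suc n))
      c∈⇒a∈ n c∈ = inverse∈ sub (add∈ sub (one∈ sub) (neg∈ sub (pow∈ sub (suc m) c∈))) (+-cancelʳ (w * x) _ _ (begin
        (1# - w) * x + w * x    ≈⟨ distribʳ x (1# - w) w ⟨
        (1# - w + w) * x        ≈⟨ *-congʳ (x-y+y≈x 1# w) ⟩
        1# * x                  ≈⟨ *-identityˡ x ⟩
        x                       ≈⟨ c-eq n ⟨
        w * x + 1#              ≈⟨ +-comm _ _ ⟩
        1# + w * x              ∎))
        where
        x = a (suc n)
        w = c (suc n) ^ suc m

      a∈⇒a-1∈ : ∀ n → L (a (suc n)) → L (a-1 n)
      a∈⇒a-1∈ n a∈ = resp∈ sub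
        (+-cancelʳ 1# _ _ (trans (x-y+y≈x (a (suc n)) 1#) (sym (c-eq n))))
        (add∈ sub a∈ (neg∈ sub (one∈ sub)))

      module _ {N} (2≤N : 2 ≤ N) (a∈ : ∀ n → n < N → L (a (suc n))) where

        c∈⇒b∈ : (∀ n → n < N → L (c (suc n))) → ∀ n → n < N → L (b (suc n))
        -- b₁ has no predecessor: it is obtained as c₂ / a₂ up to a constant. Indices are shifted by
        -- one, so `2≤N` is what makes index 1 available.
        c∈⇒b∈ c∈ zero    _   = factor∈ sub (*-comm _ _) (a#0 1) (a∈ 1 2≤N)
          (∈-cong-root ([bₙaₙ₊₁]^m≈cₙ₊₁^m 0) (c∈ 1 2≤N))
        c∈⇒b∈ c∈ (suc n) n<N = ∈-cong-root (bₙ₊₁^m≈[aₙ₊₁[aₙ-1]cₙ]^m n)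
          (mul∈ sub (a∈ (suc n) n<N) (mul∈ sub (a∈⇒a-1∈ n (a∈ n (ℕ.<⇒≤ n<N))) (c∈ n (ℕ.<⇒≤ n<N))))

        b∈⇒c∈ : (∀ n → n < N → L (b (suc n))) → ∀ n → n < N → L (c (suc n))
        b∈⇒c∈ b∈ (suc n) n<N = ∈-cong-root (sym ([bₙaₙ₊₁]^m≈cₙ₊₁^m n))
          (mul∈ sub (b∈ n (ℕ.<⇒≤ n<N)) (a∈ (suc n) n<N))
        b∈⇒c∈ b∈ zero    0<N with zero-or-apart (c 1)
        -- If c₁ vanishes, so does `a-1 0`, and division by it is impossible; but then c₁ = 0 lies
        -- in `L` anyway.
        ... | inj₁ c≈0 = resp∈ sub (sym c≈0) (zero∈ sub)
        -- b₂ is a₂ (a₁ - 1) c₁ up to a constant; dividing by a₂ and by the now nonzero a₁ - 1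
        -- leaves c₁.
        ... | inj₂ c#0 = factor∈ sub refl (x#0y#0→xy#0 (^-#0 c#0 (suc m)) (a#0 0)) (a∈⇒a-1∈ 0 (a∈ 0 0<N))
          (factor∈ sub refl (a#0 1) (a∈ 1 2≤N)
            (∈-cong-root (sym (bₙ₊₁^m≈[aₙ₊₁[aₙ-1]cₙ]^m 0)) (b∈ 1 2≤N)))

    -- Comparison of the two towers by their generators.

    image⊆C : ∀ n → image ⊆ C c n
    image⊆C zero    x∈ = x∈
    image⊆C (suc n) x∈ = base (image⊆C n x∈)

    image⊆H : ∀ n → image ⊆ H a b n
    image⊆H zero    x∈ = x∈
    image⊆H (suc n) x∈ = base (base (image⊆H n x∈))

    c∈C : ∀ n k → k < n → C c n (c (suc k))
    c∈C (suc n) k k<n with ℕ.m≤n⇒m<n∨m≡n (ℕ.s≤s⁻¹ k<n)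
    ... | inj₁ k<n′  = base (c∈C n k k<n′)
    ... | inj₂ ≡.refl = gen

    a∈H : ∀ n k → k < n → H a b n (a (suc k))
    a∈H (suc n) k k<n with ℕ.m≤n⇒m<n∨m≡n (ℕ.s≤s⁻¹ k<n)
    ... | inj₁ k<n′  = base (base (a∈H n k k<n′))
    ... | inj₂ ≡.refl = base gen

    b∈H : ∀ n k → k < n → H a b n (b (suc k))
    b∈H (suc n) k k<n with ℕ.m≤n⇒m<n∨m≡n (ℕ.s≤s⁻¹ k<n)
    ... | inj₁ k<n′  = base (base (b∈H n k k<n′))
    ... | inj₂ ≡.refl = gen

    module _ {p} {L : Pred Carrier p} (sub : IsSubfield L) (F⊆L : image ⊆ L) where

      C-least : ∀ n → (∀ k → k < n → L (c (suc k))) → C c n ⊆ L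
      C-least zero    c∈ = F⊆L
      C-least (suc n) c∈ = adjoin-least sub (C-least n (λ k k<n → c∈ k (ℕ.m<n⇒m<1+n k<n))) (c∈ n ℕ.≤-refl)

      H-least : ∀ n → (∀ k → k < n → L (a (suc k))) → (∀ k → k < n → L (b (suc k))) → H a b n ⊆ L
      H-least zero    a∈ b∈ = F⊆L
      H-least (suc n) a∈ b∈ = adjoin-least sub
        (adjoin-least sub
          (H-least n (λ k k<n → a∈ k (ℕ.m<n⇒m<1+n k<n)) (λ k k<n → b∈ k (ℕ.m<n⇒m<1+n k<n)))
          (a∈ n ℕ.≤-refl))
        (b∈ n ℕ.≤-refl)

    H≐C : ∀ n → 2 ≤ n → H a b n ≐ C c n
    -- Matching on a successor makes both fields unfold to adjunctions, which are subfields by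
    -- construction.
    H≐C n@(suc _) 2≤n = H⊆C , C⊆H
      where
      C-sub : IsSubfield (C c n)
      C-sub = adjoin-isSubfield _ _

      H-sub : IsSubfield (H a b n)
      H-sub = adjoin-isSubfield _ _

      H⊆C : H a b n ⊆ C c n
      H⊆C = H-least C-sub (image⊆C n) n a∈ (c∈⇒b∈ C-sub (image⊆C n) 2≤n a∈ (c∈C n))
        where a∈ = λ k k<n → c∈⇒a∈ C-sub (image⊆C n) k (c∈C n k k<n)

      C⊆H : C c n ⊆ H a b n
      C⊆H = C-least H-sub (image⊆H n) n (b∈⇒c∈ H-sub (image⊆H n) 2≤n (a∈H n) (b∈H n))

-- Prime powers, and passage from the stated equations to those without denominators.

primePower>1 : ∀ {q} → IsPrimePower q → 1 < q
primePower>1 (p , k , p-prime , 1≤k , ≡.refl) = begin-strict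
  1         <⟨ nonTrivial⇒n>1 p ⟩
  p         ≡⟨ ℕ.*-identityʳ p ⟨
  p ℕ.^ 1   ≤⟨ ℕ.^-monoʳ-≤ p 1≤k ⟩
  p ℕ.^ k   ∎
  where
  open ℕ.≤-Reasoning
  instance
    _ = prime⇒nonTrivial p-prime
    _ = prime⇒nonZero p-prime

-- The order of `F` is p^(k d) and annihilates 1, so `F` has characteristic p. The embedding carries
-- this to `Ω`, where the p-Frobenius is iterated `k` times.
primePower-frobenius : ∀ {q} → IsPrimePower q →
  (F : Field c ℓ₁ ℓ₂) → ∀ d → HasCardinality F (q ℕ.^ d) →
  (Ω : Field c ℓ₁ ℓ₂) (ι : Field.Carrier F → Field.Carrier Ω) → IsEmbedding F Ω ι →
  let open Field Ω in ∀ x y → (x + y) ^ q ≈ x ^ q + y ^ q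
primePower-frobenius (p , k , p-prime , _ , ≡.refl) F d finite Ω ι embedding =
  frobenius-+-iterate p-prime p·1≈0 k
  where
  open Field Ω hiding (zero)
  open FieldProperties Ω
  open RingMorphisms.IsRingHomomorphism embedding
  module F = FieldProperties F

  p·1≈0 : p · 1# ≈ 0#
  p·1≈0 = trans (sym (Embedding.·1-homo F Ω ι embedding p)) (trans
    (⟦⟧-cong (F.p^k·1≈0⇒p·1≈0 p (k ℕ.* d)
      (≡.subst (λ n → Field._≈_ F (n F.· Field.1# F) (Field.0# F)) (ℕ.^-*-assoc p k d) (FiniteField.N·1≈0 F finite))))
    0#-homo)

mainTheorem1 :
  ∀ {c₀ ℓ₁ ℓ₂ : Level} (q : ℕ) → IsPrimePower q →
  (F : Field c₀ ℓ₁ ℓ₂) → HasCardinality F (q ℕ.^ 3) →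
  (Ω : Field c₀ ℓ₁ ℓ₂) (ι : Field.Carrier F → Field.Carrier Ω) → IsEmbedding F Ω ι →
  let open Field Ω
      open Extension F Ω ι
  in
  (a b c : ℕ → Carrier) →
  IsTranscendental (a 1) →
  IsAlgebraicClosureOf (image ⟮ a 1 ⟯) →
  (a#0 : ∀ n → 1 ≤ n → a n # 0#) →
  (∀ n (1≤n : 1 ≤ n) →
    (1# - a (suc n)) / a (suc n) ^ q ⟨ ^-#0 (a#0 (suc n) (s≤s z≤n)) q ⟩
      ≈ (a n ^ q + a n - 1#) / a n ⟨ a#0 n 1≤n ⟩) →
  (∀ n (1≤n : 1 ≤ n) → c n ^ (q ∸ 1) ≈ 1# - 1# / a n ⟨ a#0 n 1≤n ⟩) →
  (∀ n (1≤n : 1 ≤ n) → b n ^ (q ∸ 1) ≈ - ((a n ^ q + a n - 1#) / a n ⟨ a#0 n 1≤n ⟩)) →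
  ∀ n → 2 ≤ n → H a b n ≐ C c n
-- Excluding q = 0 and q = 1 makes `q ∸ 1` reduce to `suc m`.
mainTheorem1 zero          pp with primePower>1 pp
... | ()
mainTheorem1 (suc zero)    pp with primePower>1 pp
... | s≤s ()
mainTheorem1 (suc (suc m)) pp F finite Ω ι embedding a b c _ _ a#0 a-eq c-eq b-eq =
  Tower.Equations.H≐C F Ω ι embedding m finite
    (primePower-frobenius pp F 3 finite Ω ι embedding)
    a b c (λ n → a#0 (suc n) (s≤s z≤n)) a-eq′ c-eq′ b-eq′
  where
  open Field Ω hiding (zero)
  open FieldProperties Ω
  open SetoidReasoning setoid

  q = suc (suc m)

  a-eq′ : ∀ n → a (suc n) + a (suc (suc n)) ^ q
                ≈ (a (suc n) ^ q + a (suc n)) * a (suc (suc n)) ^ q + a (suc (suc n)) * a (suc n)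
  -- Adding y x + y^q to the cross-multiplied recursion (1 - y) x = (x^q + x - 1) y^q removes its
  -- subtractions.
  a-eq′ n = begin
    x + z                         ≈⟨ +-cong (*-identityˡ x) (*-identityˡ z) ⟨
    1# * x + 1# * z               ≈⟨ +-congʳ (*-congʳ (x-y+y≈x 1# y)) ⟨
    (1# - y + y) * x + 1# * z     ≈⟨ +-congʳ (distribʳ x (1# - y) y) ⟩
    ((1# - y) * x + y * x) + 1# * z ≈⟨ +-congʳ (+-congʳ (cross-multiply (a-eq (suc n) (s≤s z≤n)))) ⟩
    ((x ^ q + x - 1#) * z + y * x) + 1# * z
      ≈⟨ solve 4 (λ s z t u → (s :* z :+ t) :+ u :* z := (s :+ u) :* z :+ t) refl (x ^ q + x - 1#) z (y * x) 1# ⟩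
    (x ^ q + x - 1# + 1#) * z + y * x ≈⟨ +-congʳ (*-congʳ (x-y+y≈x (x ^ q + x) 1#)) ⟩
    (x ^ q + x) * z + y * x       ∎
    where
    x = a (suc n)
    y = a (suc (suc n))
    z = y ^ q

  c-eq′ : ∀ n → c (suc n) ^ suc m * a (suc n) + 1# ≈ a (suc n)
  c-eq′ n = begin
    c (suc n) ^ suc m * x + 1#   ≈⟨ +-cong (*-congʳ (c-eq (suc n) (s≤s z≤n))) (sym (/-* 1# x x#0)) ⟩
    (1# - r) * x + r * x         ≈⟨ distribʳ x (1# - r) r ⟨
    (1# - r + r) * x             ≈⟨ *-congʳ (x-y+y≈x 1# r) ⟩
    1# * x                       ≈⟨ *-identityˡ x ⟩
    x                            ∎
    where
    x = a (suc n)
    x#0 = a#0 (suc n) (s≤s z≤n)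
    r = 1# / x ⟨ x#0 ⟩

  b-eq′ : ∀ n → b (suc n) ^ suc m * a (suc n) + (a (suc n) ^ q + a (suc n)) ≈ 1#
  b-eq′ n = begin
    b (suc n) ^ suc m * x + s           ≈⟨ +-cong (*-congʳ (b-eq (suc n) (s≤s z≤n))) (sym (x-y+y≈x s 1#)) ⟩
    - r * x + (s - 1# + 1#)             ≈⟨ +-congˡ (+-congʳ (/-* (s - 1#) x x#0)) ⟨
    - r * x + (r * x + 1#)              ≈⟨ +-assoc (- r * x) (r * x) 1# ⟨
    - r * x + r * x + 1#                ≈⟨ +-congʳ (distribʳ x (- r) r) ⟨
    (- r + r) * x + 1#                  ≈⟨ +-congʳ (trans (*-congʳ (-‿inverseˡ r)) (zeroˡ x)) ⟩
    0# + 1#                             ≈⟨ +-identityˡ 1# ⟩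
    1#                                  ∎
    where
    x = a (suc n)
    s = x ^ q + x
    x#0 = a#0 (suc n) (s≤s z≤n)
    r = (s - 1#) / x ⟨ x#0 ⟩
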